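{- Let $k\ge 1$ be an integer and let $G=(V_1\cup V_2,E)$ be a connected bipartite graph with stable sets $V_1,V_2$, $n=n_1+n_2$ vertices where $n_1=|V_1|$, $n_2=|V_2|$, and diameter $D\ge 2$. Then its $k$-tuple graph $G^{kV_1}$, which has $kn_1+n_2$ vertices, has diameter $D$, and its spectrum consists of the values $\sqrt{k}\,\lambda$ for each eigenvalue $\lambda$ of $G$ (counted with multiplicity), together with the eigenvalue $0$ with additional multiplicity $(k-1)n_1$.
   Context: The $k$-tuple graph $G^{kV_1}$ of a bipartite graph $G$ with stable sets $V_1,V_2$ is obtained by replacing each vertex $u\in V_1$ by $k$ vertices $u_1,\ldots,u_k$, each having the same neighbourhood (in $V_2$) as $u$ had in $G$. The spectrum of a graph is the multiset of eigenvalues of its adjacency matrix. -}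

module Defs where

open import Level using (Level)
open import Data.Bool using (Bool; true; false; if_then_else_)
open import Data.Nat using (ℕ; zero; suc; _+_; _*_; _<_; _≤_; _∸_)
open import Data.Fin using (Fin; zero; suc; splitAt; quotRem; punchIn; _≟_)
open import Data.Sum using (inj₁; inj₂)
open import Data.Product using (_×_; ∃; ∃-syntax; Σ; _,_; proj₁)
open import Data.List using (List; []; _∷_; map; foldr; _++_; replicate)
open import Data.Unit.Polymorphic using () renaming (⊤ to ⊤ₗ)
open import Relation.Nullary using (¬_; yes; no)
open import Relation.Binary.PropositionalEquality using (_≡_)
open import Algebra.Bundles using (CommutativeRing)

Adj : ℕ → Set
Adj N = Fin N → Fin N → Bool

data Walk {N : ℕ} (A : Adj N) : Fin N → Fin N → ℕ → Set where
  here : ∀ {u} → Walk A u u zero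
  step : ∀ {u w v ℓ} → A u w ≡ true → Walk A w v ℓ → Walk A u v (suc ℓ)

Connected : ∀ {N} → Adj N → Set
Connected A = ∀ u v → ∃[ ℓ ] Walk A u v ℓ

Distance : ∀ {N} → Adj N → Fin N → Fin N → ℕ → Set
Distance A u v d = Walk A u v d × (∀ ℓ → ℓ < d → ¬ Walk A u v ℓ)

Diameter : ∀ {N} → Adj N → ℕ → Set
Diameter A D =
  (∀ u v → ∃[ d ] (d ≤ D × Distance A u v d)) ×
  (∃[ u ] ∃[ v ] Distance A u v D)

-- Bipartite graphs with stable sets V₁ = Fin n₁, V₂ = Fin n₂, given by
-- the biadjacency relation B : V₁ → V₂ → Bool.  The vertex set is
-- Fin (n₁ + n₂), the first n₁ vertices forming V₁ and the last n₂ V₂.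

bipAdj : (n₁ n₂ : ℕ) → (Fin n₁ → Fin n₂ → Bool) → Adj (n₁ + n₂)
bipAdj n₁ n₂ B x y with splitAt n₁ x | splitAt n₁ y
... | inj₁ u | inj₂ v = B u v
... | inj₂ v | inj₁ u = B u v
... | inj₁ _ | inj₁ _ = false
... | inj₂ _ | inj₂ _ = false

-- The k-tuple graph G^{kV₁}: V₁ is replaced by Fin (k * n₁) ≅ Fin n₁ × Fin k,
-- the copy (u , i) of u having the same neighbourhood in V₂ as u.
tupleBiadj : (k n₁ n₂ : ℕ) → (Fin n₁ → Fin n₂ → Bool) →
             Fin (k * n₁) → Fin n₂ → Bool
tupleBiadj k n₁ n₂ B x v = B (proj₁ (quotRem {k} n₁ x)) v

tupleAdj : (k n₁ n₂ : ℕ) → (Fin n₁ → Fin n₂ → Bool) → Adj (k * n₁ + n₂)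
tupleAdj k n₁ n₂ B = bipAdj (k * n₁) n₂ (tupleBiadj k n₁ n₂ B)

-- Linear algebra over a commutative ring R: polynomials in R[X] (as
-- coefficient lists, lowest degree first), determinants (Laplace
-- expansion along the first row), characteristic polynomials, spectra.

module LinAlg {c ℓ : Level} (R : CommutativeRing c ℓ) where
  open CommutativeRing R hiding (_+_; _*_; zero)
  open CommutativeRing R using () renaming (_+_ to _+ᴿ_; _*_ to _*ᴿ_)

  Poly : Set c
  Poly = List Carrier

  _≈ₚ_ : Poly → Poly → Set ℓ
  []       ≈ₚ []       = ⊤ₗ
  []       ≈ₚ (b ∷ q) = (b ≈ 0#) × ([] ≈ₚ q)
  (a ∷ p) ≈ₚ []       = (a ≈ 0#) × (p ≈ₚ [])
  (a ∷ p) ≈ₚ (b ∷ q) = (a ≈ b) × (p ≈ₚ q)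

  _+ₚ_ : Poly → Poly → Poly
  []       +ₚ q       = q
  (a ∷ p) +ₚ []       = a ∷ p
  (a ∷ p) +ₚ (b ∷ q) = (a +ᴿ b) ∷ (p +ₚ q)

  -ₚ_ : Poly → Poly
  -ₚ p = map -_ p

  _*ₚ_ : Poly → Poly → Poly
  []       *ₚ q = []
  (a ∷ p) *ₚ q = map (a *ᴿ_) q +ₚ (0# ∷ (p *ₚ q))

  const : Carrier → Poly
  const a = a ∷ []

  X : Poly
  X = 0# ∷ 1# ∷ []

  fromℕ : ℕ → Carrier
  fromℕ zero    = 0#
  fromℕ (suc m) = 1# +ᴿ fromℕ m

  module Det {a : Level} {S : Set a} (_⊕_ _⊗_ : S → S → S) (⊖_ : S → S)
             (𝟘 𝟙 : S) where
    altSum : ∀ {m} → (Fin m → S) → S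
    altSum {zero}  f = 𝟘
    altSum {suc m} f = f zero ⊕ (⊖ altSum (λ j → f (suc j)))

    det : ∀ {m} → (Fin m → Fin m → S) → S
    det {zero}  M = 𝟙
    det {suc m} M =
      altSum (λ j → M zero j ⊗ det (λ r s → M (suc r) (punchIn j s)))

  charPoly : ∀ {m} → (Fin m → Fin m → Carrier) → Poly
  charPoly {m} M = Det.det _+ₚ_ _*ₚ_ -ₚ_ [] (const 1#) N
    where
    N : Fin m → Fin m → Poly
    N i j with i ≟ j
    ... | yes _ = X +ₚ (-ₚ const (M i j))
    ... | no  _ = -ₚ const (M i j)

  linProd : List Carrier → Poly
  linProd = foldr (λ λᵢ p → (X +ₚ (-ₚ const λᵢ)) *ₚ p) (const 1#)

  adjMatrix : ∀ {N} → Adj N → Fin N → Fin N → Carrier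
  adjMatrix A i j = if A i j then 1# else 0#

  IsSpectrum : ∀ {N} → Adj N → List Carrier → Set ℓ
  IsSpectrum A λs = charPoly (adjMatrix A) ≈ₚ linProd λs

{-# OPTIONS --safe #-}
module Submission where

-- Order the vertices with V₁ first, so that XI − aA has blocks XI, −aN, −aNᵀ, XI
-- with N the biadjacency matrix.  Block elimination gives
--   X^n₂ · det(XI − aA) = X^n₁ · det(X²I − a²NᵀN).
-- The biadjacency matrix of the k-tuple graph repeats each row of N k times, so
-- its Gram matrix is kNᵀN = s²NᵀN: the k-tuple graph (with a = 1) and the matrix
-- sA (with a = s) share the determinant on the right, and X^n₂ can be cancelled.
-- The spectrum of sA is s times that of A because det(XI − sA) and ∏(X − sλ) are
-- both the degree-n homogenisation, at Y = s, of the polynomial det(XI − A) = ∏(X − λ)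
-- (substituting sX for X would not do, since s may be a zero divisor).
-- For the diameter, walks of positive length between two vertices of the k-tuple
-- graph are the walks between their originals, and distinct copies of a vertex
-- are at distance 2.

open import Defs
open import Level using (Level; _⊔_)
open import Data.Bool using (Bool; true; false; if_then_else_)
open import Data.Nat using (ℕ; zero; suc; _≤_; _<_; _∸_; z≤n; s≤s) renaming (_+_ to _+ℕ_; _*_ to _*ℕ_)
import Data.Nat.Properties as ℕ
open import Data.Fin using (Fin; zero; suc; splitAt; quotRem; punchIn; _↑ˡ_; _↑ʳ_; _≟_)
open import Data.Fin.Properties using (splitAt-↑ˡ; splitAt-↑ʳ; splitAt⁻¹-↑ˡ; splitAt⁻¹-↑ʳ; join-splitAt)
open import Data.Fin.Properties using (↑ˡ-injective; ↑ʳ-injective; suc-injective; 0≢1+n)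
open import Data.Sum using (inj₁; inj₂; [_,_]′)
open import Data.Product using (Σ; _×_; ∃-syntax; _,_; proj₁; proj₂)
open import Data.List using (List; []; _∷_; map; length; _++_; replicate)
open import Function using (_∘_)
open import Relation.Nullary using (¬_; yes; no; contradiction)
open import Relation.Binary using (tri<; tri≈; tri>)
open import Relation.Binary.PropositionalEquality as ≡ using (_≡_; _≢_)
open import Algebra.Bundles using (CommutativeRing; AbelianGroup)
import Algebra.Properties.Ring
import Algebra.Properties.CommutativeSemigroup
import Algebra.Properties.Semiring.Exp
import Algebra.Properties.Semiring.Sum
import Algebra.Solver.Ring.NaturalCoefficients.Default
import Relation.Binary.Reasoning.Setoid

-- Distances in the k-tuple graph

-- The setting abstracts the k-tuple graph: `x` is a copy of its original `π x`, adjacency is pulled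
-- back along `π`, and `σ` selects one copy of each vertex.
module Blowup {N M : ℕ} (A : Adj N) (A′ : Adj M)
              (π : Fin M → Fin N) (σ : Fin N → Fin M)
              (π∘σ : ∀ a → π (σ a) ≡ a)
              (A′-π : ∀ x y → A′ x y ≡ A (π x) (π y)) where

  project : ∀ {x y l} → Walk A′ x y l → Walk A (π x) (π y) l
  project here                     = here
  project (step {u} {w} u∼w walk) = step (≡.trans (≡.sym (A′-π u w)) u∼w) (project walk)

  -- Inner vertices of the walk are replaced by their selected copies, while the endpoints may be
  -- any copies. Length 0 is excluded because distinct copies of a vertex are not joined by the
  -- empty walk.
  lift : ∀ x y {a b l} → π x ≡ a → π y ≡ b → Walk A a b (suc l) → Walk A′ x y (suc l)
  lift x y ≡.refl πy≡b (step x∼y here) =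
    step (≡.trans (A′-π x y) (≡.trans (≡.cong (A (π x)) πy≡b) x∼y)) here
  lift x y ≡.refl πy≡b (step {w = w} x∼w walk@(step _ _)) =
    step (≡.trans (A′-π x (σ w)) (≡.trans (≡.cong (A (π x)) (π∘σ w)) x∼w))
         (lift (σ w) y (π∘σ w) πy≡b walk)

  lift-distance-≡ : ∀ {x y d} → x ≡ y → Distance A (π x) (π y) d → Distance A′ x y d
  lift-distance-≡ {d = zero}  ≡.refl _              = here , λ _ ()
  lift-distance-≡ {d = suc d} ≡.refl (_ , shortest) =
    contradiction here (shortest 0 (s≤s z≤n))

  -- Distinct originals force a positive distance, so a shortest walk lifts; any shorter walk
  -- between the copies would project to a shorter one below.
  lift-distance-≢ : ∀ {x y d} → π x ≢ π y → Distance A (π x) (π y) d → Distance A′ x y d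
  lift-distance-≢ {d = zero} πx≢πy (walk , _) = contradiction (nil⇒≡ walk) πx≢πy
    where
    nil⇒≡ : ∀ {a b} → Walk A a b 0 → a ≡ b
    nil⇒≡ here = ≡.refl
  lift-distance-≢ {x} {y} {suc d} _ (walk , shortest) =
    lift x y ≡.refl ≡.refl walk , λ l l<d w → shortest l l<d (project w)

  module _ (A-sym : ∀ a b → A a b ≡ A b a) (A-irrefl : ∀ a → A a a ≡ false) where

    -- A neighbour of the common original gives a walk of length 2; a walk of length 1 would project
    -- to a loop.
    twin-distance : ∀ {x y b} → x ≢ y → π x ≡ π y → A (π x) b ≡ true → Distance A′ x y 2
    twin-distance {x} {y} {b} x≢y πx≡πy x∼b =
      lift x y ≡.refl ≡.refl (step x∼b (step b∼y here)) , shortest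
      where
      b∼y : A b (π y) ≡ true
      b∼y = ≡.trans (A-sym b (π y)) (≡.trans (≡.cong (λ a → A a b) (≡.sym πx≡πy)) x∼b)

      shortest : ∀ l → l < 2 → ¬ Walk A′ x y l
      shortest 0 _ here = x≢y ≡.refl
      shortest 1 _ (step x∼y here)
        with () ← ≡.trans (≡.sym (A-irrefl (π x)))
                   (≡.trans (≡.cong (A (π x)) πx≡πy) (≡.trans (≡.sym (A′-π x y)) x∼y))
      shortest (suc (suc _)) (s≤s (s≤s ())) _

    -- Only distinct copies of one vertex acquire a new distance, namely 2, and `2 ≤ D` keeps it
    -- within the bound. The value `D` is attained at selected copies of a pair attaining it below.
    diameter : ∀ {D} → (∀ a → ∃[ b ] A a b ≡ true) → 2 ≤ D → Diameter A D → Diameter A′ D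
    diameter {D} neighbour 2≤D (bound , a , b , a-b) =
      bound′ , σ a , σ b , lift-distance-≢ σa≢σb a-b′
      where
      a-b′ : Distance A (π (σ a)) (π (σ b)) D
      a-b′ rewrite π∘σ a | π∘σ b = a-b

      σa≢σb : π (σ a) ≢ π (σ b)
      σa≢σb eq = proj₂ a-b′ 0 (ℕ.≤-trans (s≤s z≤n) 2≤D)
                   (≡.subst (λ c → Walk A (π (σ a)) c 0) eq here)

      bound′ : ∀ x y → ∃[ d ] (d ≤ D × Distance A′ x y d)
      bound′ x y with x ≟ y | π x ≟ π y
      ... | yes x≡y | _         = let d , d≤D , dist = bound (π x) (π y) in
                                   d , d≤D , lift-distance-≡ x≡y dist
      ... | no x≢y  | yes πx≡πy = 2 , 2≤D , twin-distance x≢y πx≡πy (proj₂ (neighbour (π x)))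
      ... | no _    | no πx≢πy  = let d , d≤D , dist = bound (π x) (π y) in
                                   d , d≤D , lift-distance-≢ πx≢πy dist

-- Bipartite adjacency and the projection from copies to originals

bipAdj-sym : ∀ n₁ n₂ B x y → bipAdj n₁ n₂ B x y ≡ bipAdj n₁ n₂ B y x
bipAdj-sym n₁ n₂ B x y with splitAt n₁ x | splitAt n₁ y
... | inj₁ _ | inj₁ _ = ≡.refl
... | inj₁ _ | inj₂ _ = ≡.refl
... | inj₂ _ | inj₁ _ = ≡.refl
... | inj₂ _ | inj₂ _ = ≡.refl

bipAdj-irrefl : ∀ n₁ n₂ B x → bipAdj n₁ n₂ B x x ≡ false
bipAdj-irrefl n₁ n₂ B x with splitAt n₁ x
... | inj₁ _ = ≡.refl
... | inj₂ _ = ≡.refl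

-- Every vertex differs from `u` or from `v`, and a walk to a different vertex has a first step.
connected⇒neighbour : ∀ {N} (A : Adj N) → Connected A → ∀ {u v} → u ≢ v →
                      ∀ a → ∃[ b ] A a b ≡ true
connected⇒neighbour A conn {u} {v} u≢v a with a ≟ u
connected⇒neighbour A conn {u} {v} u≢v a | no a≢u with conn a u
... | _ , here       = contradiction ≡.refl a≢u
... | _ , step a∼b _ = _ , a∼b
connected⇒neighbour A conn {u} {v} u≢v a | yes ≡.refl with conn a v
... | _ , here       = contradiction ≡.refl u≢v
... | _ , step a∼b _ = _ , a∼b

-- The copies form consecutive blocks of `n` indices, each running once through the originals. This
-- lemma and the next peel off the first block.
quotRem-↑ˡ : ∀ k n (i : Fin n) → proj₁ (quotRem {suc k} n (i ↑ˡ (k *ℕ n))) ≡ i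
quotRem-↑ˡ k n i rewrite splitAt-↑ˡ n i (k *ℕ n) = ≡.refl

quotRem-↑ʳ : ∀ k n (i : Fin (k *ℕ n)) →
             proj₁ (quotRem {suc k} n (n ↑ʳ i)) ≡ proj₁ (quotRem {k} n i)
quotRem-↑ʳ k n i rewrite splitAt-↑ʳ n (k *ℕ n) i = ≡.refl

original : ∀ k n₁ n₂ → Fin (k *ℕ n₁ +ℕ n₂) → Fin (n₁ +ℕ n₂)
original k n₁ n₂ x = [ (λ i → proj₁ (quotRem {k} n₁ i) ↑ˡ n₂) , n₁ ↑ʳ_ ]′ (splitAt (k *ℕ n₁) x)

tupleAdj-original : ∀ k n₁ n₂ B x y →
  tupleAdj k n₁ n₂ B x y ≡ bipAdj n₁ n₂ B (original k n₁ n₂ x) (original k n₁ n₂ y)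
tupleAdj-original k n₁ n₂ B x y with splitAt (k *ℕ n₁) x | splitAt (k *ℕ n₁) y
... | inj₁ i | inj₁ j
  rewrite splitAt-↑ˡ n₁ (proj₁ (quotRem {k} n₁ i)) n₂
        | splitAt-↑ˡ n₁ (proj₁ (quotRem {k} n₁ j)) n₂ = ≡.refl
... | inj₁ i | inj₂ j
  rewrite splitAt-↑ˡ n₁ (proj₁ (quotRem {k} n₁ i)) n₂ | splitAt-↑ʳ n₁ n₂ j = ≡.refl
... | inj₂ i | inj₁ j
  rewrite splitAt-↑ʳ n₁ n₂ i | splitAt-↑ˡ n₁ (proj₁ (quotRem {k} n₁ j)) n₂ = ≡.refl
... | inj₂ i | inj₂ j
  rewrite splitAt-↑ʳ n₁ n₂ i | splitAt-↑ʳ n₁ n₂ j = ≡.refl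

firstCopy : ∀ k n₁ n₂ → Fin (n₁ +ℕ n₂) → Fin (suc k *ℕ n₁ +ℕ n₂)
firstCopy k n₁ n₂ a = [ (λ i → (i ↑ˡ (k *ℕ n₁)) ↑ˡ n₂) , (suc k *ℕ n₁) ↑ʳ_ ]′ (splitAt n₁ a)

original-firstCopy : ∀ k n₁ n₂ a → original (suc k) n₁ n₂ (firstCopy k n₁ n₂ a) ≡ a
original-firstCopy k n₁ n₂ a with splitAt n₁ a in eq
... | inj₁ i
  rewrite splitAt-↑ˡ (suc k *ℕ n₁) (i ↑ˡ (k *ℕ n₁)) n₂ | splitAt-↑ˡ n₁ i (k *ℕ n₁) = splitAt⁻¹-↑ˡ eq
... | inj₂ j
  rewrite splitAt-↑ʳ (suc k *ℕ n₁) n₂ j = splitAt⁻¹-↑ʳ eq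

-- Determinants

-- The hypotheses say that (`j` , `l`) and (`j′` , `l′`) name the same two columns in opposite
-- orders. Deleting both leaves the same columns in increasing order either way.
punchIn-exchange : ∀ {m} (j : Fin (suc (suc m))) (l : Fin (suc m)) {j′ l′} →
                   punchIn j l ≡ j′ → punchIn j′ l′ ≡ j →
                   ∀ s → punchIn j (punchIn l s) ≡ punchIn j′ (punchIn l′ s)
punchIn-exchange zero    l       {l′ = zero}   ≡.refl _  s = ≡.refl
punchIn-exchange (suc j) zero                  ≡.refl eq s =
  ≡.cong (λ i → suc (punchIn i s)) (≡.sym (suc-injective eq))
punchIn-exchange (suc j) (suc l) {l′ = suc l′} ≡.refl eq zero    = ≡.refl
punchIn-exchange (suc j) (suc l) {l′ = suc l′} ≡.refl eq (suc s) =
  ≡.cong suc (punchIn-exchange j l ≡.refl (suc-injective eq) s)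

-- R₀ is the parameter of the module in which Defs places Det; the determinants
-- are over S.
module Determinant {c₀ ℓ₀ c ℓ : Level} (R₀ : CommutativeRing c₀ ℓ₀) (S : CommutativeRing c ℓ) where
  open CommutativeRing S hiding (zero)
  open LinAlg.Det R₀ _+_ _*_ -_ 0# 1# public
  open Algebra.Properties.Ring ring using (-‿distribʳ-*; -‿distribˡ-*; -‿+-comm; -0#≈0#; +-inverseˡ-unique)
  open Algebra.Properties.CommutativeSemigroup +-commutativeSemigroup using (interchange)
  open Algebra.Properties.CommutativeSemigroup *-commutativeSemigroup using (x∙yz≈y∙xz)
  open Algebra.Properties.Semiring.Exp semiring using (_^_)
  open Algebra.Properties.Semiring.Sum semiring using (sum; sum-cong-≋)
  open Algebra.Solver.Ring.NaturalCoefficients.Default commutativeSemiring using (solve; _:+_; _:*_; _:=_)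
  open Relation.Binary.Reasoning.Setoid setoid

  Matrix : ℕ → Set c
  Matrix m = Fin m → Fin m → Carrier

  minor : ∀ {m} → Matrix (suc m) → Fin (suc m) → Matrix m
  minor M j r s = M (suc r) (punchIn j s)

  laplace : ∀ {m} → Matrix (suc m) → Fin (suc m) → Carrier
  laplace M j = M zero j * det (minor M j)

  altSum-cong : ∀ {m} {f g : Fin m → Carrier} → (∀ j → f j ≈ g j) → altSum f ≈ altSum g
  altSum-cong {zero}  f≈g = refl
  altSum-cong {suc m} f≈g = +-cong (f≈g zero) (-‿cong (altSum-cong (f≈g ∘ suc)))

  altSum-+ : ∀ {m} (f g : Fin m → Carrier) → altSum (λ j → f j + g j) ≈ altSum f + altSum g
  altSum-+ {zero}  f g = sym (+-identityˡ 0#)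
  altSum-+ {suc m} f g = begin
    (f zero + g zero) + - altSum (λ j → f (suc j) + g (suc j))
      ≈⟨ +-congˡ (-‿cong (altSum-+ (f ∘ suc) (g ∘ suc))) ⟩
    (f zero + g zero) + - (altSum (f ∘ suc) + altSum (g ∘ suc))
      ≈⟨ +-congˡ (-‿+-comm _ _) ⟨
    (f zero + g zero) + (- altSum (f ∘ suc) + - altSum (g ∘ suc))
      ≈⟨ interchange _ _ _ _ ⟩
    altSum f + altSum g ∎

  altSum-neg : ∀ {m} (f : Fin m → Carrier) → altSum (λ j → - f j) ≈ - altSum f
  altSum-neg {zero}  f = sym -0#≈0#
  altSum-neg {suc m} f = trans (+-congˡ (-‿cong (altSum-neg (f ∘ suc)))) (-‿+-comm _ _)

  altSum-*ˡ : ∀ {m} a (f : Fin m → Carrier) → altSum (λ j → a * f j) ≈ a * altSum f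
  altSum-*ˡ {zero}  a f = sym (zeroʳ a)
  altSum-*ˡ {suc m} a f = begin
    a * f zero + - altSum (λ j → a * f (suc j)) ≈⟨ +-congˡ (-‿cong (altSum-*ˡ a (f ∘ suc))) ⟩
    a * f zero + - (a * altSum (f ∘ suc))       ≈⟨ +-congˡ (-‿distribʳ-* _ _) ⟩
    a * f zero + a * - altSum (f ∘ suc)         ≈⟨ distribˡ _ _ _ ⟨
    a * altSum f                                ∎

  altSum-zero : ∀ {m} {f : Fin m → Carrier} → (∀ j → f j ≈ 0#) → altSum f ≈ 0#
  altSum-zero {zero}  f≈0 = refl
  altSum-zero {suc m} f≈0 =
    trans (+-cong (f≈0 zero) (trans (-‿cong (altSum-zero (f≈0 ∘ suc))) -0#≈0#)) (+-identityˡ 0#)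

  -- The index pair (j , l) stands for the ordered pair of distinct columns
  -- (j , punchIn j l); exchanging the two columns flips the sign.
  altSum₂-symmetric : ∀ {m} (h : Fin (suc m) → Fin m → Carrier) →
    (∀ j l {j′ l′} → punchIn j l ≡ j′ → punchIn j′ l′ ≡ j → h j l ≈ h j′ l′) →
    altSum (λ j → altSum (h j)) ≈ 0#
  altSum₂-symmetric {zero}  h h-sym = trans (+-identityˡ _) -0#≈0#
  altSum₂-symmetric {suc m} h h-sym = begin
    altSum (h zero) + - altSum (λ j → h (suc j) zero + - altSum (h (suc j) ∘ suc))
      ≈⟨ +-congˡ (-‿cong (altSum-+ (λ j → h (suc j) zero) (λ j → - altSum (h (suc j) ∘ suc)))) ⟩
    altSum (h zero) + - (altSum (λ j → h (suc j) zero) + altSum (λ j → - altSum (h (suc j) ∘ suc)))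
      -- The pairs with column 0 second match those with column 0 first, and the pairs avoiding
      -- column 0 vanish by induction.
      ≈⟨ +-congˡ (-‿cong (+-cong (altSum-cong (λ j → sym (h-sym zero j ≡.refl ≡.refl)))
           (trans (altSum-neg (λ j → altSum (h (suc j) ∘ suc))) (trans (-‿cong rest≈0) -0#≈0#)))) ⟩
    altSum (h zero) + - (altSum (h zero) + 0#)
      ≈⟨ +-congˡ (-‿cong (+-identityʳ _)) ⟩
    altSum (h zero) + - altSum (h zero)
      ≈⟨ -‿inverseʳ _ ⟩
    0# ∎
    where
    rest≈0 : altSum (λ j → altSum (h (suc j) ∘ suc)) ≈ 0#
    rest≈0 = altSum₂-symmetric (λ j l → h (suc j) (suc l))
      (λ j l p q → h-sym (suc j) (suc l) (≡.cong suc p) (≡.cong suc q))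

  det-cong : ∀ {m} {M N : Matrix m} → (∀ i j → M i j ≈ N i j) → det M ≈ det N
  det-cong {zero}  M≈N = refl
  det-cong {suc m} M≈N =
    altSum-cong λ j → *-cong (M≈N zero j) (det-cong (λ r s → M≈N (suc r) (punchIn j s)))

  rows₂ : ∀ {m} (u r : Fin (suc (suc m)) → Carrier) →
          (Fin m → Fin (suc (suc m)) → Carrier) → Matrix (suc (suc m))
  rows₂ u r L zero          = u
  rows₂ u r L (suc zero)    = r
  rows₂ u r L (suc (suc i)) = L i

  -- The part of the double expansion carrying w is symmetric in the two columns,
  -- so det vanishes on equal rows even when 2 is not cancellable.
  det-swap : ∀ {m} u r w (L : Fin m → Fin (suc (suc m)) → Carrier) →
             det (rows₂ u (λ j → r j + w * u j) L) + det (rows₂ r u L) ≈ 0#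
  det-swap {m} u r w L = begin
    det (rows₂ u (λ j → r j + w * u j) L) + det (rows₂ r u L)
      ≈⟨ altSum-+ (laplace (rows₂ u (λ j → r j + w * u j) L)) (laplace (rows₂ r u L)) ⟨
    altSum (λ j → u j * altSum (λ l → (r (punchIn j l) + w * u (punchIn j l)) * D j l)
                + r j * altSum (λ l → u (punchIn j l) * D j l))
      ≈⟨ altSum-cong {g = λ j → altSum (h j)} (λ j → trans
           (+-cong (sym (altSum-*ˡ (u j) λ l → (r (punchIn j l) + w * u (punchIn j l)) * D j l))
                   (sym (altSum-*ˡ (r j) λ l → u (punchIn j l) * D j l)))
           (sym (altSum-+ (λ l → u j * ((r (punchIn j l) + w * u (punchIn j l)) * D j l))
                          (λ l → r j * (u (punchIn j l) * D j l))))) ⟩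
    altSum (λ j → altSum (h j))
      ≈⟨ altSum₂-symmetric h h-sym ⟩
    0# ∎
    where
    D : Fin (suc (suc m)) → Fin (suc m) → Carrier
    D j l = det (λ p q → L p (punchIn j (punchIn l q)))

    -- Expanded, this is `(u j * r k + r j * u k + w * (u j * u k)) *
    -- d`, visibly symmetric in `j` and `k`.
    t : Fin (suc (suc m)) → Fin (suc (suc m)) → Carrier → Carrier
    t j k d = u j * ((r k + w * u k) * d) + r j * (u k * d)

    h : Fin (suc (suc m)) → Fin (suc m) → Carrier
    h j l = t j (punchIn j l) (D j l)

    t-sym : ∀ j k d → t j k d ≈ t k j d
    t-sym j k d = solve 6 (λ uj rj uk rk w d →
      uj :* ((rk :+ w :* uk) :* d) :+ rj :* (uk :* d) :=
      uk :* ((rj :+ w :* uj) :* d) :+ rk :* (uj :* d)) refl (u j) (r j) (u k) (r k) w d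

    h-sym : ∀ j l {j′ l′} → punchIn j l ≡ j′ → punchIn j′ l′ ≡ j → h j l ≈ h j′ l′
    h-sym j l {j′} {l′} p q = begin
      t j (punchIn j l) (D j l)      ≡⟨ ≡.cong (λ k → t j k (D j l)) p ⟩
      t j j′ (D j l)                 ≈⟨ t-sym j j′ (D j l) ⟩
      t j′ j (D j l)                 ≈⟨ +-cong (*-congˡ (*-congˡ D≈)) (*-congˡ (*-congˡ D≈)) ⟩
      t j′ j (D j′ l′)               ≡⟨ ≡.cong (λ k → t j′ k (D j′ l′)) q ⟨
      t j′ (punchIn j′ l′) (D j′ l′) ∎
      where
      D≈ : D j l ≈ D j′ l′
      D≈ = det-cong λ a b → reflexive (≡.cong (L a) (punchIn-exchange j l p q b))

  -- `det-swap` absorbs the multiple added to the second row and exchanges the first two rows. After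
  -- expansion along `r`, the row `u` heads every minor, so induction treats the rows below; a swap
  -- with multiplier 0 restores the order.
  det-addFirstRow : ∀ {m} (M N : Matrix (suc m)) (v : Fin m → Carrier) →
    (∀ j → N zero j ≈ M zero j) →
    (∀ i j → N (suc i) j ≈ M (suc i) j + v i * M zero j) →
    det N ≈ det M
  det-addFirstRow {zero}  M N v N₀ N₊ = altSum-cong {f = laplace N} {laplace M} λ j → *-congʳ (N₀ j)
  det-addFirstRow {suc m} M N v N₀ N₊ = begin
    det N                                        ≈⟨ det-cong N≈ ⟩
    det (rows₂ u (λ j → r j + v zero * u j) LN)  ≈⟨ +-inverseˡ-unique _ _ (det-swap u r (v zero) LN) ⟩
    - det (rows₂ r u LN)                         ≈⟨ -‿cong swapped ⟩
    - det (rows₂ r u LM)                         ≈⟨ +-inverseˡ-unique _ _ (det-swap u r 0# LM) ⟨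
    det (rows₂ u (λ j → r j + 0# * u j) LM)      ≈⟨ det-cong M≈ ⟨
    det M                                        ∎
    where
    u r : Fin (suc (suc m)) → Carrier
    u = M zero
    r = M (suc zero)

    LM LN : Fin m → Fin (suc (suc m)) → Carrier
    LM i = M (suc (suc i))
    LN i = N (suc (suc i))

    N≈ : ∀ i j → N i j ≈ rows₂ u (λ j → r j + v zero * u j) LN i j
    N≈ zero          j = N₀ j
    N≈ (suc zero)    j = N₊ zero j
    N≈ (suc (suc i)) j = refl

    M≈ : ∀ i j → M i j ≈ rows₂ u (λ j → r j + 0# * u j) LM i j
    M≈ zero          j = refl
    M≈ (suc zero)    j = sym (trans (+-congˡ (zeroˡ _)) (+-identityʳ _))
    M≈ (suc (suc i)) j = refl

    minors : ∀ j → det (minor (rows₂ r u LN) j) ≈ det (minor (rows₂ r u LM) j)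
    minors j = det-addFirstRow (minor (rows₂ r u LM) j) (minor (rows₂ r u LN) j)
      (v ∘ suc) (λ _ → refl) (λ i q → N₊ (suc i) (punchIn j q))

    swapped : det (rows₂ r u LN) ≈ det (rows₂ r u LM)
    swapped = altSum-cong {f = laplace (rows₂ r u LN)} {laplace (rows₂ r u LM)}
      λ j → *-congˡ {r j} (minors j)

  det-zeroColumn : ∀ {m} (M : Matrix (suc m)) → (∀ i → M i zero ≈ 0#) → det M ≈ 0#
  det-zeroColumn {m} M M≈0 = altSum-zero {f = laplace M} (term≈0 m M M≈0)
    where
    term≈0 : ∀ m (M : Matrix (suc m)) → (∀ i → M i zero ≈ 0#) → ∀ j → laplace M j ≈ 0#
    term≈0 m       M M≈0 zero    = trans (*-congʳ (M≈0 zero)) (zeroˡ _)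
    term≈0 (suc m) M M≈0 (suc j) =
      trans (*-congˡ (det-zeroColumn (minor M (suc j)) (M≈0 ∘ suc))) (zeroʳ _)

  -- Every minor other than the corner one retains the first column, which is zero below the corner.
  det-corner : ∀ {m} (M : Matrix (suc m)) → (∀ i → M (suc i) zero ≈ 0#) →
               det M ≈ M zero zero * det (minor M zero)
  det-corner {m} M M≈0 = begin
    laplace M zero + - altSum (laplace M ∘ suc)
      ≈⟨ +-congˡ (-‿cong (altSum-zero {f = laplace M ∘ suc} (term≈0 m M M≈0))) ⟩
    laplace M zero + - 0#
      ≈⟨ trans (+-congˡ -0#≈0#) (+-identityʳ _) ⟩
    laplace M zero ∎
    where
    term≈0 : ∀ m (M : Matrix (suc m)) → (∀ i → M (suc i) zero ≈ 0#) → ∀ j → laplace M (suc j) ≈ 0#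
    term≈0 (suc m) M M≈0 j = trans (*-congˡ (det-zeroColumn (minor M (suc j)) M≈0)) (zeroʳ _)

  det-scaleLower : ∀ m {n} x (M N : Matrix (m +ℕ n)) →
    (∀ i j → N (i ↑ˡ n) j ≈ M (i ↑ˡ n) j) →
    (∀ i j → N (m ↑ʳ i) j ≈ x * M (m ↑ʳ i) j) →
    det N ≈ x ^ n * det M
  det-scaleLower zero {zero} x M N Nˡ Nʳ = sym (*-identityˡ 1#)
  det-scaleLower zero {suc n} x M N Nˡ Nʳ = begin
    altSum (laplace N)
      ≈⟨ altSum-cong {f = laplace N} (λ j → trans (*-cong (Nʳ zero j)
           (det-scaleLower zero x (minor M j) (minor N j) (λ ()) (λ r s → Nʳ (suc r) (punchIn j s))))
           (solve 4 (λ x a y d → (x :* a) :* (y :* d) := (x :* y) :* (a :* d))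
             refl x (M zero j) (x ^ n) (det (minor M j)))) ⟩
    altSum (λ j → x ^ suc n * laplace M j)
      ≈⟨ altSum-*ˡ (x ^ suc n) (laplace M) ⟩
    x ^ suc n * altSum (laplace M) ∎
  det-scaleLower (suc m) {n} x M N Nˡ Nʳ = begin
    altSum (laplace N)
      ≈⟨ altSum-cong {f = laplace N} (λ j → trans (*-cong (Nˡ zero j)
           (det-scaleLower m x (minor M j) (minor N j)
             (λ r s → Nˡ (suc r) (punchIn j s)) (λ r s → Nʳ r (punchIn j s))))
           (x∙yz≈y∙xz (M zero j) (x ^ n) (det (minor M j)))) ⟩
    altSum (λ j → x ^ n * laplace M j)
      ≈⟨ altSum-*ˡ (x ^ n) (laplace M) ⟩
    x ^ n * altSum (laplace M) ∎

  -- Block elimination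

  record ScalarBlock (m : ℕ) {n : ℕ} (x : Carrier) (M : Matrix (m +ℕ n)) : Set (c ⊔ ℓ) where
    field
      diagonal    : ∀ i → M (i ↑ˡ n) (i ↑ˡ n) ≈ x
      offDiagonal : ∀ {i j} → i ≢ j → M (i ↑ˡ n) (j ↑ˡ n) ≈ 0#

  open ScalarBlock

  -- Elimination clears the lower left block one column at a time and leaves the Schur complement.
  -- Division by `x` is avoided by supplying the quotient of that block as `V`.
  det-eliminate : ∀ m {n} x (M : Matrix (m +ℕ n)) (V : Fin n → Fin m → Carrier) →
    ScalarBlock m x M → (∀ i l → M (m ↑ʳ i) (l ↑ˡ n) ≈ x * V i l) →
    det M ≈ x ^ m * det (λ i j → M (m ↑ʳ i) (m ↑ʳ j) - sum (λ l → V i l * M (l ↑ˡ n) (m ↑ʳ j)))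
  det-eliminate zero x M V xI Mˡ = sym (trans (*-identityˡ _)
    (det-cong {N = M} λ i j → trans (+-congˡ -0#≈0#) (+-identityʳ _)))
  det-eliminate (suc m) {n} x M V xI Mˡ = begin
    det M
      ≈⟨ det-addFirstRow M N v (λ _ → refl) (λ _ _ → refl) ⟨
    det N
      ≈⟨ det-corner N column≈0 ⟩
    M zero zero * det N′
      ≈⟨ *-cong (diagonal xI zero) (det-eliminate m x N′ (λ i l → V i (suc l)) xI′ N′ˡ) ⟩
    x * (x ^ m * det (λ i j → N′ (m ↑ʳ i) (m ↑ʳ j) - sum (λ l → V i (suc l) * N′ (l ↑ˡ n) (m ↑ʳ j))))
      ≈⟨ *-assoc _ _ _ ⟨
    x ^ suc m * det (λ i j → N′ (m ↑ʳ i) (m ↑ʳ j) - sum (λ l → V i (suc l) * N′ (l ↑ˡ n) (m ↑ʳ j)))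
      ≈⟨ *-congˡ (det-cong entry) ⟩
    x ^ suc m * det (λ i j → M (suc m ↑ʳ i) (suc m ↑ʳ j) - sum (λ l → V i l * M (l ↑ˡ n) (suc m ↑ʳ j))) ∎
    where
    -- The remaining rows of the scalar block already vanish in the pivot column, so their
    -- multiplier is 0.
    v : Fin (m +ℕ n) → Carrier
    v a = [ (λ _ → 0#) , (λ i → - V i zero) ]′ (splitAt m a)

    N : Matrix (suc m +ℕ n)
    N zero    j = M zero j
    N (suc i) j = M (suc i) j + v i * M zero j

    N′ : Matrix (m +ℕ n)
    N′ i j = N (suc i) (suc j)

    Nᵘ : ∀ i j → N (suc (i ↑ˡ n)) j ≈ M (suc (i ↑ˡ n)) j
    Nᵘ i j rewrite splitAt-↑ˡ m i n = trans (+-congˡ (zeroˡ _)) (+-identityʳ _)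

    Nˡ : ∀ i j → N (suc (m ↑ʳ i)) j ≈ M (suc (m ↑ʳ i)) j + - V i zero * M zero j
    Nˡ i j rewrite splitAt-↑ʳ m n i = refl

    column≈0 : ∀ i → N (suc i) zero ≈ 0#
    column≈0 a with splitAt m a | join-splitAt m n a
    ... | inj₁ i | ≡.refl = trans (+-cong (offDiagonal xI (0≢1+n ∘ ≡.sym)) (zeroˡ _)) (+-identityˡ 0#)
    ... | inj₂ i | ≡.refl = begin
      M (suc (m ↑ʳ i)) zero + - V i zero * M zero zero
        ≈⟨ +-cong (trans (Mˡ i zero) (*-comm _ _)) (trans (*-congˡ (diagonal xI zero)) (sym (-‿distribˡ-* _ _))) ⟩
      V i zero * x - V i zero * x
        ≈⟨ -‿inverseʳ _ ⟩
      0# ∎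

    xI′ : ScalarBlock m x N′
    xI′ .diagonal i      = trans (Nᵘ i _) (diagonal xI (suc i))
    xI′ .offDiagonal i≢j = trans (Nᵘ _ _) (offDiagonal xI (i≢j ∘ suc-injective))

    N′ˡ : ∀ i l → N′ (m ↑ʳ i) (l ↑ˡ n) ≈ x * V i (suc l)
    N′ˡ i l = begin
      N′ (m ↑ʳ i) (l ↑ˡ n)
        ≈⟨ Nˡ i _ ⟩
      M (suc (m ↑ʳ i)) (suc (l ↑ˡ n)) + - V i zero * M zero (suc (l ↑ˡ n))
        ≈⟨ +-cong (Mˡ i (suc l)) (trans (*-congˡ (offDiagonal xI 0≢1+n)) (zeroʳ _)) ⟩
      x * V i (suc l) + 0#
        ≈⟨ +-identityʳ _ ⟩
      x * V i (suc l) ∎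

    -- The correction made by this pivot is the `l = zero` term of the sum; the upper rows are
    -- unchanged.
    entry : ∀ i j → N′ (m ↑ʳ i) (m ↑ʳ j) - sum (λ l → V i (suc l) * N′ (l ↑ˡ n) (m ↑ʳ j))
                  ≈ M (suc m ↑ʳ i) (suc m ↑ʳ j) - sum (λ l → V i l * M (l ↑ˡ n) (suc m ↑ʳ j))
    entry i j = begin
      N′ (m ↑ʳ i) (m ↑ʳ j) - sum (λ l → V i (suc l) * N′ (l ↑ˡ n) (m ↑ʳ j))
        ≈⟨ +-cong (Nˡ i _) (-‿cong (sum-cong-≋ λ l → *-congˡ (Nᵘ l _))) ⟩
      (M (suc m ↑ʳ i) (suc m ↑ʳ j) + - V i zero * M zero (suc m ↑ʳ j)) - rest
        ≈⟨ +-congʳ (+-congˡ (-‿distribˡ-* _ _)) ⟨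
      (M (suc m ↑ʳ i) (suc m ↑ʳ j) + - (V i zero * M zero (suc m ↑ʳ j))) - rest
        ≈⟨ +-assoc _ _ _ ⟩
      M (suc m ↑ʳ i) (suc m ↑ʳ j) + (- (V i zero * M zero (suc m ↑ʳ j)) - rest)
        ≈⟨ +-congˡ (-‿+-comm _ _) ⟩
      M (suc m ↑ʳ i) (suc m ↑ʳ j) - (V i zero * M zero (suc m ↑ʳ j) + rest) ∎
      where
      rest : Carrier
      rest = sum (λ l → V i (suc l) * M (suc l ↑ˡ n) (suc m ↑ʳ j))

  -- Scaling the lower rows by `x` costs `x ^ n` and makes the lower left block divisible by `x`,
  -- with the original block as its quotient.
  det-blocks : ∀ m {n} x (M : Matrix (m +ℕ n)) → ScalarBlock m x M →
    x ^ n * det M ≈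
    x ^ m * det (λ i j → x * M (m ↑ʳ i) (m ↑ʳ j)
                        - sum (λ l → M (m ↑ʳ i) (l ↑ˡ n) * M (l ↑ˡ n) (m ↑ʳ j)))
  det-blocks m {n} x M xI = begin
    x ^ n * det M
      ≈⟨ det-scaleLower m x M N Nᵘ Nˡ ⟨
    det N
      ≈⟨ det-eliminate m x N (λ i l → M (m ↑ʳ i) (l ↑ˡ n)) xI′ (λ i l → Nˡ i _) ⟩
    x ^ m * det (λ i j → N (m ↑ʳ i) (m ↑ʳ j) - sum (λ l → M (m ↑ʳ i) (l ↑ˡ n) * N (l ↑ˡ n) (m ↑ʳ j)))
      ≈⟨ *-congˡ (det-cong λ i j →
           +-cong (Nˡ i _) (-‿cong (sum-cong-≋ λ l → *-congˡ (Nᵘ l _)))) ⟩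
    x ^ m * det (λ i j → x * M (m ↑ʳ i) (m ↑ʳ j)
                        - sum (λ l → M (m ↑ʳ i) (l ↑ˡ n) * M (l ↑ˡ n) (m ↑ʳ j))) ∎
    where
    N : Matrix (m +ℕ n)
    N i j = [ (λ _ → M i j) , (λ _ → x * M i j) ]′ (splitAt m i)

    Nᵘ : ∀ i j → N (i ↑ˡ n) j ≈ M (i ↑ˡ n) j
    Nᵘ i j rewrite splitAt-↑ˡ m i n = refl

    Nˡ : ∀ i j → N (m ↑ʳ i) j ≈ x * M (m ↑ʳ i) j
    Nˡ i j rewrite splitAt-↑ʳ m n i = refl

    xI′ : ScalarBlock m x N
    xI′ .diagonal i      = trans (Nᵘ i _) (diagonal xI i)
    xI′ .offDiagonal i≢j = trans (Nᵘ _ _) (offDiagonal xI i≢j)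

-- Polynomials and characteristic polynomials

module Polynomial {c ℓ : Level} (R : CommutativeRing c ℓ) where
  open CommutativeRing R hiding (zero)
  open LinAlg R
  open Algebra.Properties.Ring ring using (-0#≈0#)
  open Algebra.Properties.CommutativeSemigroup *-commutativeSemigroup using (x∙yz≈y∙xz)

  coef : Poly → ℕ → Carrier
  coef []      _       = 0#
  coef (a ∷ p) zero    = a
  coef (a ∷ p) (suc i) = coef p i

  -- Equivalent to _≈ₚ_, which computes and hence hides its arguments from
  -- unification.
  infix 4 _≋_
  record _≋_ (p q : Poly) : Set ℓ where
    constructor coefficientwise
    field at : ∀ i → coef p i ≈ coef q i
  open _≋_ public

  ≈ₚ⇒≋ : ∀ p q → p ≈ₚ q → p ≋ q
  ≈ₚ⇒≋ p q p≈q .at = go p q p≈q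
    where
    go : ∀ p q → p ≈ₚ q → ∀ i → coef p i ≈ coef q i
    go []      []      _           i       = refl
    go []      (b ∷ q) (b≈0 , q≈0) zero    = sym b≈0
    go []      (b ∷ q) (b≈0 , q≈0) (suc i) = go [] q q≈0 i
    go (a ∷ p) []      (a≈0 , p≈0) zero    = a≈0
    go (a ∷ p) []      (a≈0 , p≈0) (suc i) = go p [] p≈0 i
    go (a ∷ p) (b ∷ q) (a≈b , p≈q) zero    = a≈b
    go (a ∷ p) (b ∷ q) (a≈b , p≈q) (suc i) = go p q p≈q i

  ≋⇒≈ₚ : ∀ p q → p ≋ q → p ≈ₚ q
  ≋⇒≈ₚ p q p≋q = go p q (at p≋q)
    where
    go : ∀ p q → (∀ i → coef p i ≈ coef q i) → p ≈ₚ q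
    go []      []      eq = _
    go []      (b ∷ q) eq = sym (eq 0) , go [] q (eq ∘ suc)
    go (a ∷ p) []      eq = eq 0 , go p [] (eq ∘ suc)
    go (a ∷ p) (b ∷ q) eq = eq 0 , go p q (eq ∘ suc)

  -const0 : ∀ {a} → a ≈ 0# → -ₚ const a ≋ []
  -const0 a≈0 .at zero    = trans (-‿cong a≈0) -0#≈0#
  -const0 a≈0 .at (suc i) = refl

  -- The commutative ring of polynomials

  infixr 25 _·_
  _·_ : Carrier → Poly → Poly
  a · p = map (a *_) p

  coef-+ : ∀ p q i → coef (p +ₚ q) i ≈ coef p i + coef q i
  coef-+ []      q       i       = sym (+-identityˡ _)
  coef-+ (a ∷ p) []      i       = sym (+-identityʳ _)
  coef-+ (a ∷ p) (b ∷ q) zero    = refl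
  coef-+ (a ∷ p) (b ∷ q) (suc i) = coef-+ p q i

  coef-neg : ∀ p i → coef (-ₚ p) i ≈ - coef p i
  coef-neg []      i       = sym -0#≈0#
  coef-neg (a ∷ p) zero    = refl
  coef-neg (a ∷ p) (suc i) = coef-neg p i

  coef-· : ∀ a p i → coef (a · p) i ≈ a * coef p i
  coef-· a []      i       = sym (zeroʳ a)
  coef-· a (b ∷ p) zero    = refl
  coef-· a (b ∷ p) (suc i) = coef-· a p i

  +ₚ-abelianGroup : AbelianGroup c ℓ
  +ₚ-abelianGroup = record
    { Carrier = Poly
    ; _≈_     = _≋_
    ; _∙_     = _+ₚ_
    ; ε       = []
    ; _⁻¹     = -ₚ_
    ; isAbelianGroup = record
      { isGroup = record
        { isMonoid = record
          { isSemigroup = record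
            { isMagma = record
              { isEquivalence = record
                { refl  = coefficientwise λ i → refl
                ; sym   = λ p → coefficientwise λ i → sym (at p i)
                ; trans = λ p q → coefficientwise λ i → trans (at p i) (at q i)
                }
              ; ∙-cong = λ {p} {p′} {q} {q′} p≋ q≋ → coefficientwise λ i →
                  trans (coef-+ p q i) (trans (+-cong (at p≋ i) (at q≋ i)) (sym (coef-+ p′ q′ i)))
              }
            ; assoc = λ p q r → coefficientwise λ i →
                trans (trans (coef-+ (p +ₚ q) r i) (+-congʳ (coef-+ p q i)))
                (trans (+-assoc _ _ _)
                (sym (trans (coef-+ p (q +ₚ r) i) (+-congˡ (coef-+ q r i)))))
            }
          ; identity = (λ p → coefficientwise λ i → refl)
                     , (λ p → coefficientwise λ i → trans (coef-+ p [] i) (+-identityʳ _))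
          }
        ; inverse = (λ p → coefficientwise λ i →
                      trans (coef-+ (-ₚ p) p i) (trans (+-congʳ (coef-neg p i)) (-‿inverseˡ _)))
                  , (λ p → coefficientwise λ i →
                      trans (coef-+ p (-ₚ p) i) (trans (+-congˡ (coef-neg p i)) (-‿inverseʳ _)))
        ; ⁻¹-cong = λ {p} {q} p≋q → coefficientwise λ i →
            trans (coef-neg p i) (trans (-‿cong (at p≋q i)) (sym (coef-neg q i)))
        }
      ; comm = λ p q → coefficientwise λ i →
          trans (coef-+ p q i) (trans (+-comm _ _) (sym (coef-+ q p i)))
      }
    }

  private
    module A = AbelianGroup +ₚ-abelianGroup
    module A-CS = Algebra.Properties.CommutativeSemigroup A.commutativeSemigroup
  open Relation.Binary.Reasoning.Setoid A.setoid

  ∷-cong : ∀ {a b p q} → a ≈ b → p ≋ q → a ∷ p ≋ b ∷ q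
  ∷-cong a≈b p≋q .at zero    = a≈b
  ∷-cong a≈b p≋q .at (suc i) = at p≋q i

  ∷-injective : ∀ {a b p q} → a ∷ p ≋ b ∷ q → a ≈ b × p ≋ q
  ∷-injective eq = at eq 0 , coefficientwise (at eq ∘ suc)

  0∷[]≋[] : 0# ∷ [] ≋ []
  0∷[]≋[] .at zero    = refl
  0∷[]≋[] .at (suc i) = refl

  0∷-+ : ∀ p q → 0# ∷ (p +ₚ q) ≋ (0# ∷ p) +ₚ (0# ∷ q)
  0∷-+ p q = ∷-cong (sym (+-identityˡ 0#)) A.refl

  ·-cong : ∀ {a b p q} → a ≈ b → p ≋ q → a · p ≋ b · q
  ·-cong {a} {b} {p} {q} a≈b p≋q .at i =
    trans (coef-· a p i) (trans (*-cong a≈b (at p≋q i)) (sym (coef-· b q i)))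

  ·-distribˡ : ∀ a p q → a · (p +ₚ q) ≋ a · p +ₚ a · q
  ·-distribˡ a p q .at i = trans (coef-· a (p +ₚ q) i) (trans (*-congˡ (coef-+ p q i))
    (trans (distribˡ _ _ _) (sym (trans (coef-+ (a · p) (a · q) i)
      (+-cong (coef-· a p i) (coef-· a q i))))))

  ·-assoc : ∀ a b p → (a * b) · p ≋ a · (b · p)
  ·-assoc a b p .at i = trans (coef-· (a * b) p i) (trans (*-assoc _ _ _)
    (sym (trans (coef-· a (b · p) i) (*-congˡ (coef-· b p i)))))

  1·-identity : ∀ p → 1# · p ≋ p
  1·-identity p .at i = trans (coef-· 1# p i) (*-identityˡ _)

  0·-zero : ∀ p → 0# · p ≋ []
  0·-zero p .at i = trans (coef-· 0# p i) (zeroˡ _)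

  *ₚ-congˡ : ∀ p {q r} → q ≋ r → p *ₚ q ≋ p *ₚ r
  *ₚ-congˡ []      q≋r = A.refl
  *ₚ-congˡ (a ∷ p) q≋r = A.∙-cong (·-cong refl q≋r) (∷-cong refl (*ₚ-congˡ p q≋r))

  *ₚ-zeroʳ : ∀ p → p *ₚ [] ≋ []
  *ₚ-zeroʳ []      = A.refl
  *ₚ-zeroʳ (a ∷ p) = A.trans (∷-cong refl (*ₚ-zeroʳ p)) 0∷[]≋[]

  -- This mirrors the defining clause of `*ₚ` in the second factor, which makes commutativity an
  -- induction.
  *ₚ-∷ʳ : ∀ p b q → p *ₚ (b ∷ q) ≋ b · p +ₚ (0# ∷ p *ₚ q)
  *ₚ-∷ʳ []      b q = A.sym 0∷[]≋[]
  *ₚ-∷ʳ (a ∷ p) b q = ∷-cong (+-congʳ (*-comm a b)) (begin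
    a · q +ₚ (p *ₚ (b ∷ q))             ≈⟨ A.∙-congˡ (*ₚ-∷ʳ p b q) ⟩
    a · q +ₚ (b · p +ₚ (0# ∷ p *ₚ q))   ≈⟨ A-CS.x∙yz≈y∙xz (a · q) (b · p) _ ⟩
    b · p +ₚ (a · q +ₚ (0# ∷ p *ₚ q))   ∎)

  *ₚ-comm : ∀ p q → p *ₚ q ≋ q *ₚ p
  *ₚ-comm []      q = A.sym (*ₚ-zeroʳ q)
  *ₚ-comm (a ∷ p) q = begin
    a · q +ₚ (0# ∷ p *ₚ q) ≈⟨ A.∙-congˡ (∷-cong refl (*ₚ-comm p q)) ⟩
    a · q +ₚ (0# ∷ q *ₚ p) ≈⟨ *ₚ-∷ʳ q a p ⟨
    q *ₚ (a ∷ p)           ∎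

  *ₚ-congʳ : ∀ p {q r} → q ≋ r → q *ₚ p ≋ r *ₚ p
  *ₚ-congʳ p {q} {r} q≋r = A.trans (*ₚ-comm q p) (A.trans (*ₚ-congˡ p q≋r) (*ₚ-comm p r))

  *ₚ-distribˡ : ∀ p q r → p *ₚ (q +ₚ r) ≋ (p *ₚ q) +ₚ (p *ₚ r)
  *ₚ-distribˡ []      q r = A.refl
  *ₚ-distribˡ (a ∷ p) q r = begin
    a · (q +ₚ r) +ₚ (0# ∷ p *ₚ (q +ₚ r))
      ≈⟨ A.∙-cong (·-distribˡ a q r) (A.trans (∷-cong refl (*ₚ-distribˡ p q r)) (0∷-+ (p *ₚ q) (p *ₚ r))) ⟩
    (a · q +ₚ a · r) +ₚ ((0# ∷ p *ₚ q) +ₚ (0# ∷ p *ₚ r))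
      ≈⟨ A-CS.interchange (a · q) (a · r) (0# ∷ p *ₚ q) (0# ∷ p *ₚ r) ⟩
    (a · q +ₚ (0# ∷ p *ₚ q)) +ₚ (a · r +ₚ (0# ∷ p *ₚ r)) ∎

  *ₚ-distribʳ : ∀ p q r → (q +ₚ r) *ₚ p ≋ (q *ₚ p) +ₚ (r *ₚ p)
  *ₚ-distribʳ p q r = A.trans (*ₚ-comm (q +ₚ r) p)
    (A.trans (*ₚ-distribˡ p q r) (A.∙-cong (*ₚ-comm p q) (*ₚ-comm p r)))

  ·-*ₚ-assoc : ∀ a p q → (a · p) *ₚ q ≋ a · (p *ₚ q)
  ·-*ₚ-assoc a []      q = A.refl
  ·-*ₚ-assoc a (b ∷ p) q = begin
    (a * b) · q +ₚ (0# ∷ (a · p) *ₚ q)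
      ≈⟨ A.∙-cong (·-assoc a b q) (∷-cong (sym (zeroʳ a)) (·-*ₚ-assoc a p q)) ⟩
    a · (b · q) +ₚ a · (0# ∷ p *ₚ q)
      ≈⟨ ·-distribˡ a (b · q) (0# ∷ p *ₚ q) ⟨
    a · (b · q +ₚ (0# ∷ p *ₚ q)) ∎

  0∷-*ₚ : ∀ p q → (0# ∷ p) *ₚ q ≋ 0# ∷ p *ₚ q
  0∷-*ₚ p q = A.∙-congʳ (0·-zero q)

  *ₚ-assoc : ∀ p q r → (p *ₚ q) *ₚ r ≋ p *ₚ (q *ₚ r)
  *ₚ-assoc []      q r = A.refl
  *ₚ-assoc (a ∷ p) q r = begin
    (a · q +ₚ (0# ∷ p *ₚ q)) *ₚ r
      ≈⟨ *ₚ-distribʳ r (a · q) (0# ∷ p *ₚ q) ⟩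
    ((a · q) *ₚ r) +ₚ ((0# ∷ p *ₚ q) *ₚ r)
      ≈⟨ A.∙-cong (·-*ₚ-assoc a q r) (A.trans (0∷-*ₚ (p *ₚ q) r) (∷-cong refl (*ₚ-assoc p q r))) ⟩
    a · (q *ₚ r) +ₚ (0# ∷ p *ₚ (q *ₚ r)) ∎

  const-*ₚ : ∀ a p → const a *ₚ p ≋ a · p
  const-*ₚ a p = A.trans (A.∙-congˡ 0∷[]≋[]) (A.identityʳ _)

  *ₚ-identityˡ : ∀ p → const 1# *ₚ p ≋ p
  *ₚ-identityˡ p = A.trans (const-*ₚ 1# p) (1·-identity p)

  polyRing : CommutativeRing c ℓ
  polyRing = record
    { Carrier = Poly
    ; _≈_     = _≋_
    ; _+_     = _+ₚ_
    ; _*_     = _*ₚ_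
    ; -_      = -ₚ_
    ; 0#      = []
    ; 1#      = const 1#
    ; isCommutativeRing = record
      { isRing = record
        { +-isAbelianGroup = A.isAbelianGroup
        ; *-cong     = λ {p} {p′} {q} {q′} p≋ q≋ → A.trans (*ₚ-congʳ q p≋) (*ₚ-congˡ p′ q≋)
        ; *-assoc    = *ₚ-assoc
        ; *-identity = *ₚ-identityˡ , λ p → A.trans (*ₚ-comm p (const 1#)) (*ₚ-identityˡ p)
        ; distrib    = *ₚ-distribˡ , *ₚ-distribʳ
        }
      ; *-comm = *ₚ-comm
      }
    }

  private
    module P = CommutativeRing polyRing
    module P* = Algebra.Properties.CommutativeSemigroup P.*-commutativeSemigroup

  X*ₚ : ∀ p → X *ₚ p ≋ 0# ∷ p
  X*ₚ p = A.trans (0∷-*ₚ (const 1#) p) (∷-cong refl (*ₚ-identityˡ p))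

  open Algebra.Properties.Semiring.Exp (CommutativeRing.semiring polyRing) public
    using () renaming (_^_ to _^ₚ_; ^-homo-* to ^ₚ-homo-*)

  -- Multiplication by `X` shifts the coefficients, so it is injective over any commutative ring.
  X^-cancel : ∀ n {p q} → (X ^ₚ n) *ₚ p ≋ (X ^ₚ n) *ₚ q → p ≋ q
  X^-cancel zero    {p} {q} eq = A.trans (A.sym (*ₚ-identityˡ p)) (A.trans eq (*ₚ-identityˡ q))
  X^-cancel (suc n) {p} {q} eq = X^-cancel n (proj₂ (∷-injective (begin
    0# ∷ (X ^ₚ n) *ₚ p    ≈⟨ X*ₚ _ ⟨
    X *ₚ ((X ^ₚ n) *ₚ p)  ≈⟨ *ₚ-assoc X (X ^ₚ n) p ⟨
    (X *ₚ (X ^ₚ n)) *ₚ p  ≈⟨ eq ⟩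
    (X *ₚ (X ^ₚ n)) *ₚ q  ≈⟨ *ₚ-assoc X (X ^ₚ n) q ⟩
    X *ₚ ((X ^ₚ n) *ₚ q)  ≈⟨ X*ₚ _ ⟩
    0# ∷ (X ^ₚ n) *ₚ q    ∎)))

  coef-X^ : ∀ n → coef (X ^ₚ n) n ≈ 1#
  coef-X^ zero    = refl
  coef-X^ (suc n) = trans (at (X*ₚ (X ^ₚ n)) (suc n)) (coef-X^ n)

  trivial : 1# ≈ 0# → ∀ p q → p ≋ q
  trivial 1≈0 p q .at i = trans (≈0 _) (sym (≈0 _))
    where
    ≈0 : ∀ a → a ≈ 0#
    ≈0 a = trans (sym (*-identityˡ a)) (trans (*-congʳ 1≈0) (zeroˡ a))

  open Determinant R polyRing

  -- Homogenisation

  module _ (s : Carrier) where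
    open Algebra.Properties.Semiring.Exp semiring using (_^_)

    -- Homogenises n p q: p has degree at most n, and q is the homogeneous form
    -- of degree n in (X , Y) that restricts to p at Y = 1, evaluated at Y = s.
    data Homogenises : ℕ → Poly → Poly → Set (c ⊔ ℓ) where
      base : ∀ {p q} a → p ≋ const a → q ≋ const a → Homogenises zero p q
      cons : ∀ {n p q} a {p′ q′} → p ≋ a ∷ p′ → q ≋ (s ^ suc n * a) ∷ q′ →
             Homogenises n p′ q′ → Homogenises (suc n) p q

    hom-cong : ∀ {n p p′ q q′} → p′ ≋ p → q′ ≋ q → Homogenises n p q → Homogenises n p′ q′
    hom-cong p≋ q≋ (base a p q)   = base a (A.trans p≋ p) (A.trans q≋ q)
    hom-cong p≋ q≋ (cons a p q h) = cons a (A.trans p≋ p) (A.trans q≋ q) h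

    -- Coefficient `i` of the form is `s ^ (n - i)` times that of `p`, so `n` and `p` determine the
    -- form.
    hom-unique : ∀ {n p p′ q q′} → p ≋ p′ → Homogenises n p q → Homogenises n p′ q′ → q ≋ q′
    hom-unique p≋p′ (base a p q) (base a′ p′ q′) =
      A.trans q (A.trans (A.trans (A.sym p) (A.trans p≋p′ p′)) (A.sym q′))
    hom-unique p≋p′ (cons a p q h) (cons a′ p′ q′ h′) =
      let a≈ , tail≋ = ∷-injective (A.trans (A.sym p) (A.trans p≋p′ p′)) in
      A.trans q (A.trans (∷-cong (*-congˡ a≈) (hom-unique tail≋ h h′)) (A.sym q′))

    hom-zero : ∀ n → Homogenises n [] []
    hom-zero zero    = base 0# (A.sym 0∷[]≋[]) (A.sym 0∷[]≋[])
    hom-zero (suc n) = cons 0# (A.sym 0∷[]≋[])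
      (A.trans (A.sym 0∷[]≋[]) (∷-cong (sym (zeroʳ _)) A.refl)) (hom-zero n)

    hom-+ : ∀ {n p q p′ q′} → Homogenises n p q → Homogenises n p′ q′ →
            Homogenises n (p +ₚ p′) (q +ₚ q′)
    hom-+ (base a p q) (base a′ p′ q′) = base (a + a′) (A.∙-cong p p′) (A.∙-cong q q′)
    hom-+ (cons a p q h) (cons a′ p′ q′ h′) = cons (a + a′) (A.∙-cong p p′)
      (A.trans (A.∙-cong q q′) (∷-cong (sym (distribˡ _ a a′)) A.refl)) (hom-+ h h′)

    hom-· : ∀ {n p q} b → Homogenises n p q → Homogenises n (b · p) (b · q)
    hom-· b (base a p q)   = base (b * a) (·-cong refl p) (·-cong refl q)
    hom-· b (cons a p q h) = cons (b * a) (·-cong refl p)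
      (A.trans (·-cong refl q) (∷-cong (x∙yz≈y∙xz b _ a) A.refl)) (hom-· b h)

    hom-neg : ∀ {n p q} → Homogenises n p q → Homogenises n (-ₚ p) (-ₚ q)
    hom-neg {p = p} {q} h = hom-cong (neg p) (neg q) (hom-· (- 1#) h)
      where
      neg : ∀ p → -ₚ p ≋ (- 1#) · p
      neg p .at i = trans (coef-neg p i) (sym (trans (coef-· (- 1#) p i)
        (Algebra.Properties.Ring.-1*x≈-x ring _)))

    -- Regarding `p` as having degree one higher multiplies its form by Y, here `s`.
    hom-raise : ∀ {n p q} → Homogenises n p q → Homogenises (suc n) p (s · q)
    hom-raise (base a p q)   = cons a p
      (A.trans (·-cong refl q) (∷-cong (*-congʳ (sym (*-identityʳ s))) A.refl)) (hom-zero 0)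
    hom-raise (cons a p q h) = cons a p
      (A.trans (·-cong refl q) (∷-cong (sym (*-assoc s _ a)) A.refl)) (hom-raise h)

    hom-shift : ∀ {n p q} → Homogenises n p q → Homogenises (suc n) (0# ∷ p) (0# ∷ q)
    hom-shift h = cons 0# A.refl (∷-cong (sym (zeroʳ _)) A.refl) h

    -- With `e` = a + bX and `f` = sa + bX, the part `a · p` is raised to degree `suc n` and picks
    -- up `s`, while X times `b · p` is shifted and does not.
    hom-* : ∀ {n e f p q} → Homogenises 1 e f → Homogenises n p q →
            Homogenises (suc n) (e *ₚ p) (f *ₚ q)
    hom-* {n} {e} {f} {p} {q} (cons a {e′} {f′} e≋ f≋ (base b e′≋ f′≋)) h =
      hom-cong (expand e≋ e′≋)
        (A.trans (expand f≋ f′≋) (A.∙-congʳ (A.trans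
          (·-cong (*-congʳ (*-identityʳ s)) A.refl) (·-assoc s a q))))
        (hom-+ (hom-raise (hom-· a h)) (hom-shift (hom-· b h)))
      where
      expand : ∀ {a e e′ p} → e ≋ a ∷ e′ → e′ ≋ const b → e *ₚ p ≋ a · p +ₚ (0# ∷ b · p)
      expand {p = p} e≋ e′≋ = A.trans (*ₚ-congʳ p e≋)
        (A.∙-congˡ (∷-cong refl (A.trans (*ₚ-congʳ p e′≋) (const-*ₚ b p))))

    hom-const : ∀ a → Homogenises 1 (const a) (const (s * a))
    hom-const a = cons a A.refl (∷-cong (*-congʳ (sym (*-identityʳ s))) A.refl) (hom-zero 0)

    hom-X : Homogenises 1 X X
    hom-X = hom-shift (base 1# A.refl A.refl)

    hom-linear : ∀ a → Homogenises 1 (X +ₚ (-ₚ const a)) (X +ₚ (-ₚ const (s * a)))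
    hom-linear a = hom-+ hom-X (hom-neg (hom-const a))

    hom-linProd : ∀ λs → Homogenises (length λs) (linProd λs) (linProd (map (s *_) λs))
    hom-linProd []       = base 1# A.refl A.refl
    hom-linProd (λ₁ ∷ λs) = hom-* (hom-linear λ₁) (hom-linProd λs)

    -- The top coefficient is multiplied by the zeroth power of `s`.
    hom-leading : ∀ {n p q} → Homogenises n p q → coef p n ≈ coef q n
    hom-leading (base a p q)   = trans (at p 0) (sym (at q 0))
    hom-leading (cons a p q h) = trans (at p _) (trans (hom-leading h) (sym (at q _)))

    hom-degree : ∀ {n p q} → Homogenises n p q → ∀ {i} → n < i → coef p i ≈ 0#
    hom-degree (base a p q)   {suc i} n<i       = at p (suc i)
    hom-degree (cons a p q h) {suc i} (s≤s n<i) = trans (at p (suc i)) (hom-degree h n<i)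

    -- Each Laplace term is a linear entry times a minor of degree one less, so `hom-*` and
    -- induction apply.
    hom-det : ∀ {m} {M N : Matrix m} → (∀ i j → Homogenises 1 (M i j) (N i j)) →
              Homogenises m (det M) (det N)
    hom-det {zero}  h = base 1# A.refl A.refl
    hom-det {suc m} {M} {N} h = hom-altSum {f = laplace M} {laplace N} λ j →
      hom-* (h zero j) (hom-det {M = minor M j} {minor N j} λ r s → h (suc r) (punchIn j s))
      where
      hom-altSum : ∀ {n m} {f g : Fin m → Poly} → (∀ j → Homogenises n (f j) (g j)) →
                   Homogenises n (altSum f) (altSum g)
      hom-altSum {n} {zero}  h = hom-zero n
      hom-altSum {m = suc m} h = hom-+ (h zero) (hom-neg (hom-altSum (h ∘ suc)))

  -- Characteristic polynomials and scaling

  SMatrix : ℕ → Set c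
  SMatrix m = Fin m → Fin m → Carrier

  -- charMatrix is the matrix local to charPoly, recovered by unification.
  charPoly-det : ∀ {m} (M : SMatrix m) → Σ (Matrix m) λ N → charPoly M ≡ det N
  charPoly-det M = _ , ≡.refl

  charMatrix : ∀ {m} → SMatrix m → Matrix m
  charMatrix M = proj₁ (charPoly-det M)

  charMatrix-diagonal : ∀ {m} (M : SMatrix m) {i j} → i ≡ j → charMatrix M i j ≡ X +ₚ (-ₚ const (M i j))
  charMatrix-diagonal M {i} {j} i≡j with i ≟ j
  ... | yes _  = ≡.refl
  ... | no i≢j = contradiction i≡j i≢j

  charMatrix-offDiagonal : ∀ {m} (M : SMatrix m) {i j} → i ≢ j → charMatrix M i j ≡ -ₚ const (M i j)
  charMatrix-offDiagonal M {i} {j} i≢j with i ≟ j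
  ... | yes i≡j = contradiction i≡j i≢j
  ... | no _    = ≡.refl

  charPoly-cong : ∀ {m} {M N : SMatrix m} → (∀ i j → M i j ≈ N i j) → charPoly M ≋ charPoly N
  charPoly-cong {m} {M} {N} M≈N = det-cong {M = charMatrix M} {charMatrix N} entry
    where
    entry : ∀ i j → charMatrix M i j ≋ charMatrix N i j
    entry i j with i ≟ j
    ... | yes _ = A.∙-congˡ {X} (A.⁻¹-cong (∷-cong {p = []} (M≈N i j) A.refl))
    ... | no _  = A.⁻¹-cong (∷-cong (M≈N i j) A.refl)

  hom-charPoly : ∀ s {m} (M : SMatrix m) → Homogenises s m (charPoly M) (charPoly (λ i j → s * M i j))
  hom-charPoly s M = hom-det s entry
    where
    entry : ∀ i j → Homogenises s 1 (charMatrix M i j) (charMatrix (λ i j → s * M i j) i j)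
    entry i j with i ≟ j
    ... | yes _ = hom-linear s (M i j)
    ... | no _  = hom-neg s (hom-const s (M i j))

  X-0≋X : ∀ {a} → a ≈ 0# → X +ₚ (-ₚ const a) ≋ X
  X-0≋X a≈0 = A.trans (A.∙-congˡ {X} (-const0 a≈0)) (A.identityʳ X)

  charPoly-zero : ∀ {m} (M : SMatrix m) → (∀ i j → M i j ≈ 0#) → charPoly M ≋ X ^ₚ m
  charPoly-zero {m} M M≈0 = go (charMatrix M)
    (λ i → A.trans (A.reflexive (charMatrix-diagonal M ≡.refl)) (X-0≋X (M≈0 i i)))
    (λ i≢j → A.trans (A.reflexive (charMatrix-offDiagonal M i≢j)) (-const0 (M≈0 _ _)))
    where
    -- Generalising to every matrix equal to XI gives a class closed under taking the corner minor.
    go : ∀ {m} (N : Matrix m) → (∀ i → N i i ≋ X) → (∀ {i j} → i ≢ j → N i j ≋ []) → det N ≋ X ^ₚ m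
    go {zero}  N d o = A.refl
    go {suc m} N d o = A.trans (det-corner N (λ i → o λ ()))
      (P.*-cong (d zero) (go (minor N zero) (d ∘ suc) (λ i≢j → o (i≢j ∘ suc-injective))))

  linProd-zero : ∀ λs → linProd (map (0# *_) λs) ≋ X ^ₚ length λs
  linProd-zero []       = A.refl
  linProd-zero (λ₁ ∷ λs) = P.*-cong (X-0≋X (zeroˡ λ₁)) (linProd-zero λs)

  -- Homogenising at s = 0 keeps only the leading term.
  charPoly-leading : ∀ {m} (M : SMatrix m) → coef (charPoly M) m ≈ 1#
  charPoly-leading {m} M = trans (hom-leading 0# (hom-charPoly 0# M))
    (trans (at (charPoly-zero (λ i j → 0# * M i j) (λ i j → zeroˡ (M i j))) m) (coef-X^ m))

  linProd-leading : ∀ λs → coef (linProd λs) (length λs) ≈ 1#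
  linProd-leading λs = trans (hom-leading 0# (hom-linProd 0# λs))
    (trans (at (linProd-zero λs) (length λs)) (coef-X^ (length λs)))

  -- If m and length λs differ, the coefficient at the larger of the two degrees
  -- is both 1 and 0, so R is the zero ring.
  charPoly-scale : ∀ s {m} (M : SMatrix m) λs → charPoly M ≋ linProd λs →
                   charPoly (λ i j → s * M i j) ≋ linProd (map (s *_) λs)
  charPoly-scale s {m} M λs eq with ℕ.<-cmp m (length λs)
  ... | tri≈ _ ≡.refl _ = hom-unique s eq (hom-charPoly s M) (hom-linProd s λs)
  ... | tri< m<l _ _ = trivial (trans (sym (linProd-leading λs))
          (trans (sym (at eq _)) (hom-degree s (hom-charPoly s M) m<l))) _ _
  ... | tri> _ _ l<m = trivial (trans (sym (charPoly-leading M))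
          (trans (at eq _) (hom-degree s (hom-linProd s λs) l<m))) _ _

  linProd-zeros : ∀ λs N → linProd (λs ++ replicate N 0#) ≋ (X ^ₚ N) *ₚ linProd λs
  linProd-zeros [] zero = A.sym (*ₚ-identityˡ _)
  linProd-zeros [] (suc N) = begin
    (X +ₚ (-ₚ const 0#)) *ₚ linProd (replicate N 0#) ≈⟨ P.*-cong (X-0≋X refl) (linProd-zeros [] N) ⟩
    X *ₚ ((X ^ₚ N) *ₚ const 1#)                     ≈⟨ *ₚ-assoc X (X ^ₚ N) (const 1#) ⟨
    (X ^ₚ suc N) *ₚ const 1#                        ∎
  linProd-zeros (λ₁ ∷ λs) N = A.trans (*ₚ-congˡ (X +ₚ (-ₚ const λ₁)) (linProd-zeros λs N))
    (P*.x∙yz≈y∙xz (X +ₚ (-ₚ const λ₁)) (X ^ₚ N) (linProd λs))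

-- Bipartite graphs

bipAdj-ˡˡ : ∀ n₁ n₂ B i j → bipAdj n₁ n₂ B (i ↑ˡ n₂) (j ↑ˡ n₂) ≡ false
bipAdj-ˡˡ n₁ n₂ B i j rewrite splitAt-↑ˡ n₁ i n₂ | splitAt-↑ˡ n₁ j n₂ = ≡.refl

bipAdj-ˡʳ : ∀ n₁ n₂ B i j → bipAdj n₁ n₂ B (i ↑ˡ n₂) (n₁ ↑ʳ j) ≡ B i j
bipAdj-ˡʳ n₁ n₂ B i j rewrite splitAt-↑ˡ n₁ i n₂ | splitAt-↑ʳ n₁ n₂ j = ≡.refl

bipAdj-ʳˡ : ∀ n₁ n₂ B i j → bipAdj n₁ n₂ B (n₁ ↑ʳ j) (i ↑ˡ n₂) ≡ B i j
bipAdj-ʳˡ n₁ n₂ B i j rewrite splitAt-↑ˡ n₁ i n₂ | splitAt-↑ʳ n₁ n₂ j = ≡.refl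

bipAdj-ʳʳ : ∀ n₁ n₂ B i j → bipAdj n₁ n₂ B (n₁ ↑ʳ i) (n₁ ↑ʳ j) ≡ false
bipAdj-ʳʳ n₁ n₂ B i j rewrite splitAt-↑ʳ n₁ n₂ i | splitAt-↑ʳ n₁ n₂ j = ≡.refl

↑ˡ≢↑ʳ : ∀ {m n} {i : Fin m} {j : Fin n} → i ↑ˡ n ≢ m ↑ʳ j
↑ˡ≢↑ʳ {i = suc i} eq = ↑ˡ≢↑ʳ (suc-injective eq)

module Bipartite {c ℓ : Level} (R : CommutativeRing c ℓ) where
  open CommutativeRing R hiding (zero)
  open LinAlg R
  open Polynomial R
  open Determinant R polyRing
  open ScalarBlock
  open Algebra.Properties.Ring ring using (-‿distribˡ-*; -‿distribʳ-*; -‿involutive)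
  open Algebra.Properties.Semiring.Sum semiring using (sum; sum-cong-≋; *-distribˡ-sum)
  open Algebra.Solver.Ring.NaturalCoefficients.Default commutativeSemiring using (solve; _:*_; _:=_)
  private
    module P = CommutativeRing polyRing
    module P* = Algebra.Properties.CommutativeSemigroup P.*-commutativeSemigroup
    module PΣ = Algebra.Properties.Semiring.Sum P.semiring

  sum-↑ : ∀ m {n} (f : Fin (m +ℕ n) → Carrier) →
          sum f ≈ sum (λ i → f (i ↑ˡ n)) + sum (λ i → f (m ↑ʳ i))
  sum-↑ zero    f = sym (+-identityˡ _)
  sum-↑ (suc m) f = trans (+-congˡ (sum-↑ m (f ∘ suc))) (sym (+-assoc _ _ _))

  -- Each of the `k` blocks of copies contributes `sum f`. This is the source of the factor k in the
  -- Gram matrix of the k-tuple graph.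
  sum-quotRem : ∀ k n (f : Fin n → Carrier) →
                sum (λ i → f (proj₁ (quotRem {k} n i))) ≈ fromℕ k * sum f
  sum-quotRem zero    n f = sym (zeroˡ _)
  sum-quotRem (suc k) n f = begin
    sum (λ i → f (proj₁ (quotRem {suc k} n i)))
      ≈⟨ sum-↑ n (λ i → f (proj₁ (quotRem {suc k} n i))) ⟩
    sum (λ i → f (proj₁ (quotRem {suc k} n (i ↑ˡ (k *ℕ n)))))
      + sum (λ i → f (proj₁ (quotRem {suc k} n (n ↑ʳ i))))
      ≈⟨ +-cong (sum-cong-≋ λ i → reflexive (≡.cong f (quotRem-↑ˡ k n i)))
                (sum-cong-≋ λ i → reflexive (≡.cong f (quotRem-↑ʳ k n i))) ⟩
    sum f + sum (λ i → f (proj₁ (quotRem {k} n i)))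
      ≈⟨ +-cong (sym (*-identityˡ _)) (sum-quotRem k n f) ⟩
    1# * sum f + fromℕ k * sum f
      ≈⟨ distribʳ _ _ _ ⟨
    (1# + fromℕ k) * sum f ∎
    where open Relation.Binary.Reasoning.Setoid setoid

  sum-const : ∀ {m} (f : Fin m → Carrier) → PΣ.sum (λ i → const (f i)) ≋ const (sum f)
  sum-const {zero}  f = P.sym 0∷[]≋[]
  sum-const {suc m} f = P.+-congˡ {const (f zero)} (sum-const (f ∘ suc))

  entry : Bool → Carrier
  entry b = if b then 1# else 0#

  -- The matrix NᵀN, whose entries count common neighbours in V₁.
  gram : ∀ {n₁ n₂} → (Fin n₁ → Fin n₂ → Bool) → Fin n₂ → Fin n₂ → Carrier
  gram B i j = sum (λ l → entry (B l i) * entry (B l j))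

  -- The matrix X²I - Γ: the characteristic matrix of the zero matrix serves as XI.
  shiftedGram : ∀ {n} → SMatrix n → Matrix n
  shiftedGram Γ i j = (X *ₚ charMatrix (λ _ _ → 0#) i j) P.- const (Γ i j)

  -- `det-blocks` applies with `x` = X because both diagonal blocks of XI - aA are XI. The signs of
  -- the two off-diagonal blocks cancel in their product a²NᵀN.
  charPoly-bipartite : ∀ n₁ n₂ B a →
    (X ^ₚ n₂) *ₚ charPoly (λ i j → a * adjMatrix (bipAdj n₁ n₂ B) i j) ≋
    (X ^ₚ n₁) *ₚ det (shiftedGram λ i j → (a * a) * gram B i j)
  charPoly-bipartite n₁ n₂ B a = P.trans
    (det-blocks n₁ X N xI)
    (P.*-congˡ {X ^ₚ n₁} (det-cong λ i j →
      P.+-cong (P.*-congˡ {X} (lower i j)) (P.-‿cong (product i j))))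
    where
    W : SMatrix (n₁ +ℕ n₂)
    W i j = a * adjMatrix (bipAdj n₁ n₂ B) i j

    N : Matrix (n₁ +ℕ n₂)
    N = charMatrix W

    W≈ : ∀ {i j b} → bipAdj n₁ n₂ B i j ≡ b → W i j ≈ a * entry b
    W≈ eq = reflexive (≡.cong (λ b → a * entry b) eq)

    xI : ScalarBlock n₁ X N
    xI .diagonal i = P.trans (P.reflexive (charMatrix-diagonal W ≡.refl))
      (X-0≋X (trans (W≈ (bipAdj-ˡˡ n₁ n₂ B i i)) (zeroʳ a)))
    xI .offDiagonal {i} {j} i≢j = P.trans (P.reflexive (charMatrix-offDiagonal W (i≢j ∘ ↑ˡ-injective n₂ i j)))
      (-const0 (trans (W≈ (bipAdj-ˡˡ n₁ n₂ B i j)) (zeroʳ a)))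

    lower : ∀ i j → N (n₁ ↑ʳ i) (n₁ ↑ʳ j) ≋ charMatrix (λ _ _ → 0#) i j
    lower i j with i ≟ j
    ... | yes ≡.refl = P.trans (P.reflexive (charMatrix-diagonal W ≡.refl))
      (P.trans (X-0≋X (trans (W≈ (bipAdj-ʳʳ n₁ n₂ B i i)) (zeroʳ a))) (P.sym (X-0≋X refl)))
    ... | no i≢j = P.trans (P.reflexive (charMatrix-offDiagonal W (i≢j ∘ ↑ʳ-injective n₁ i j)))
      (P.trans (-const0 (trans (W≈ (bipAdj-ʳʳ n₁ n₂ B i j)) (zeroʳ a))) (P.sym (-const0 refl)))

    offˡ : ∀ i l → N (n₁ ↑ʳ i) (l ↑ˡ n₂) ≋ const (- (a * entry (B l i)))
    offˡ i l = P.trans (P.reflexive (charMatrix-offDiagonal W (↑ˡ≢↑ʳ ∘ ≡.sym)))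
      (∷-cong (-‿cong (W≈ (bipAdj-ʳˡ n₁ n₂ B l i))) P.refl)

    offʳ : ∀ l j → N (l ↑ˡ n₂) (n₁ ↑ʳ j) ≋ const (- (a * entry (B l j)))
    offʳ l j = P.trans (P.reflexive (charMatrix-offDiagonal W ↑ˡ≢↑ʳ))
      (∷-cong (-‿cong (W≈ (bipAdj-ˡʳ n₁ n₂ B l j))) P.refl)

    neg² : ∀ x y → - (a * x) * - (a * y) ≈ (a * a) * (x * y)
    neg² x y = trans (sym (-‿distribˡ-* _ _)) (trans (-‿cong (sym (-‿distribʳ-* _ _)))
      (trans (-‿involutive _)
        (solve 3 (λ a x y → (a :* x) :* (a :* y) := (a :* a) :* (x :* y)) refl a x y)))

    product : ∀ i j → PΣ.sum (λ l → N (n₁ ↑ʳ i) (l ↑ˡ n₂) *ₚ N (l ↑ˡ n₂) (n₁ ↑ʳ j)) ≋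
                      const ((a * a) * gram B i j)
    product i j = begin
      PΣ.sum (λ l → N (n₁ ↑ʳ i) (l ↑ˡ n₂) *ₚ N (l ↑ˡ n₂) (n₁ ↑ʳ j))
        ≈⟨ PΣ.sum-cong-≋ (λ l → P.trans (P.*-cong (offˡ i l) (offʳ l j))
             (P.trans (const-*ₚ _ _) (∷-cong (neg² _ _) P.refl))) ⟩
      PΣ.sum (λ l → const ((a * a) * (entry (B l i) * entry (B l j))))
        ≈⟨ sum-const (λ l → (a * a) * (entry (B l i) * entry (B l j))) ⟩
      const (sum (λ l → (a * a) * (entry (B l i) * entry (B l j))))
        ≈⟨ ∷-cong (*-distribˡ-sum (a * a) (λ l → entry (B l i) * entry (B l j))) P.refl ⟨
      const ((a * a) * gram B i j) ∎
      where open Relation.Binary.Reasoning.Setoid P.setoid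

  -- After multiplication by `X ^ₚ n₂` both sides contain the same Gram determinant; V₁ has grown by
  -- `k` blocks of `n₁`, which accounts for the extra power of X.
  charPoly-tuple : ∀ k n₁ n₂ B s → s * s ≈ fromℕ (suc k) →
    charPoly (adjMatrix (tupleAdj (suc k) n₁ n₂ B)) ≋
    (X ^ₚ (k *ℕ n₁)) *ₚ charPoly (λ i j → s * adjMatrix (bipAdj n₁ n₂ B) i j)
  charPoly-tuple k n₁ n₂ B s s²≈k = X^-cancel n₂ (begin
    (X ^ₚ n₂) *ₚ charPoly (adjMatrix (tupleAdj (suc k) n₁ n₂ B))
      ≈⟨ P.*-congˡ {X ^ₚ n₂} (charPoly-cong {M = adjMatrix (tupleAdj (suc k) n₁ n₂ B)}
           λ i j → sym (*-identityˡ _)) ⟩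
    (X ^ₚ n₂) *ₚ charPoly (λ i j → 1# * adjMatrix (tupleAdj (suc k) n₁ n₂ B) i j)
      ≈⟨ charPoly-bipartite (suc k *ℕ n₁) n₂ T 1# ⟩
    (X ^ₚ (suc k *ℕ n₁)) *ₚ det (shiftedGram λ i j → (1# * 1#) * gram T i j)
      ≈⟨ P.*-cong power (det-cong λ i j → P.+-congˡ {X *ₚ charMatrix (λ _ _ → 0#) i j}
           (P.-‿cong (∷-cong (gram-tuple i j) P.refl))) ⟩
    ((X ^ₚ (k *ℕ n₁)) *ₚ (X ^ₚ n₁)) *ₚ det (shiftedGram λ i j → (s * s) * gram B i j)
      ≈⟨ P.*-assoc (X ^ₚ (k *ℕ n₁)) (X ^ₚ n₁) _ ⟩
    (X ^ₚ (k *ℕ n₁)) *ₚ ((X ^ₚ n₁) *ₚ det (shiftedGram λ i j → (s * s) * gram B i j))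
      ≈⟨ P.*-congˡ {X ^ₚ (k *ℕ n₁)} (charPoly-bipartite n₁ n₂ B s) ⟨
    (X ^ₚ (k *ℕ n₁)) *ₚ ((X ^ₚ n₂) *ₚ charPoly sA)
      ≈⟨ P*.x∙yz≈y∙xz (X ^ₚ (k *ℕ n₁)) (X ^ₚ n₂) (charPoly sA) ⟩
    (X ^ₚ n₂) *ₚ ((X ^ₚ (k *ℕ n₁)) *ₚ charPoly sA) ∎)
    where
    open Relation.Binary.Reasoning.Setoid P.setoid

    T : Fin (suc k *ℕ n₁) → Fin n₂ → Bool
    T = tupleBiadj (suc k) n₁ n₂ B

    sA : SMatrix (n₁ +ℕ n₂)
    sA i j = s * adjMatrix (bipAdj n₁ n₂ B) i j

    power : X ^ₚ (suc k *ℕ n₁) ≋ (X ^ₚ (k *ℕ n₁)) *ₚ (X ^ₚ n₁)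
    power = P.trans (^ₚ-homo-* X n₁ (k *ℕ n₁)) (P.*-comm (X ^ₚ n₁) (X ^ₚ (k *ℕ n₁)))

    -- Repeating rows multiplies the Gram matrix by `fromℕ (suc k)`, and scaling by `s` multiplies
    -- it by `s * s`; the hypothesis on `s` equates the two.
    gram-tuple : ∀ i j → (1# * 1#) * gram T i j ≈ (s * s) * gram B i j
    gram-tuple i j = trans (trans (*-congʳ (*-identityˡ 1#)) (*-identityˡ _))
      (trans (sum-quotRem (suc k) n₁ (λ l → entry (B l i) * entry (B l j))) (*-congʳ (sym s²≈k)))

-- Diameter and spectrum of the k-tuple graph

open import Data.Nat using (_*_)

theorem4p4 : {c ℓ : Level} (k n₁ n₂ D : ℕ) → 1 ≤ k →
    (B : Fin n₁ → Fin n₂ → Bool) →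
    Connected (bipAdj n₁ n₂ B) → Diameter (bipAdj n₁ n₂ B) D → 2 ≤ D →
    Diameter (tupleAdj k n₁ n₂ B) D ×
    ((R : CommutativeRing c ℓ) →
    (s : CommutativeRing.Carrier R) →
    CommutativeRing._≈_ R (CommutativeRing._*_ R s s) (LinAlg.fromℕ R k) →
    (λs : List (CommutativeRing.Carrier R)) →
    LinAlg.IsSpectrum R (bipAdj n₁ n₂ B) λs →
    LinAlg.IsSpectrum R (tupleAdj k n₁ n₂ B)
    (map (CommutativeRing._*_ R s) λs ++ replicate ((k ∸ 1) * n₁) (CommutativeRing.0# R)))
theorem4p4 (suc k) n₁ n₂ D _ B conn diam@(_ , u , v , _ , shortest) 2≤D = diameter′ , spectrum
  where
  diameter′ : Diameter (tupleAdj (suc k) n₁ n₂ B) D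
  diameter′ = Blowup.diameter (bipAdj n₁ n₂ B) (tupleAdj (suc k) n₁ n₂ B)
    (original (suc k) n₁ n₂) (firstCopy k n₁ n₂) (original-firstCopy k n₁ n₂)
    (tupleAdj-original (suc k) n₁ n₂ B) (bipAdj-sym n₁ n₂ B) (bipAdj-irrefl n₁ n₂ B)
    (connected⇒neighbour (bipAdj n₁ n₂ B) conn u≢v) 2≤D diam
    where
    -- A pair at distance `D` is distinct because `2 ≤ D` rules out the empty walk.
    u≢v : u ≢ v
    u≢v ≡.refl = shortest 0 (ℕ.≤-trans (s≤s z≤n) 2≤D) here

  spectrum : (R : CommutativeRing _ _) → _
  -- The matrix `s` times A yields the scaled eigenvalues, and the power of X yields the appended
  -- zeros.
  spectrum R s s²≈k λs spec = ≋⇒≈ₚ _ _ (P.trans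
    (charPoly-tuple k n₁ n₂ B s s²≈k)
    (P.trans (P.*-congˡ {X ^ₚ (k * n₁)} (charPoly-scale s (adjMatrix (bipAdj n₁ n₂ B)) λs (≈ₚ⇒≋ _ _ spec)))
             (P.sym (linProd-zeros (map (CommutativeRing._*_ R s) λs) (k * n₁)))))
    where
    open LinAlg R
    open Polynomial R
    open Bipartite R
    module P = CommutativeRing polyRing
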